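{- For all integers $k\geq 1$ and $\delta\geq 0$, there are infinitely many (pairwise non-isomorphic) digraphs $G$ with minimum outdegree $\delta$ such that for every function $f:V(G)\to\{1,\dots,k\}$ (that is, every vertex $k$-colouring of $G$, not required to be proper), there is a vertex $v$ of $G$ such that all the out-neighbours of $v$ receive the same colour under $f$.
   Context: Digraphs are finite, with no loops and no parallel arcs (a pair of oppositely directed arcs $uv$ and $vu$ is allowed). -}

module Defs where

open import Data.Bool using (Bool; false; T)
open import Data.Fin using (Fin)
open import Data.Fin.Subset using (Subset; ∣_∣)
open import Data.Nat using (ℕ; _≤_)
open import Data.Product using (Σ-syntax; ∃-syntax; _×_)
open import Data.Vec using (tabulate)
open import Function.Bundles using (_↔_; Inverse)
open import Relation.Binary.PropositionalEquality using (_≡_)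

-- The Boolean-valued adjacency rules out parallel arcs; it need not be
-- symmetric or antisymmetric, so opposite arcs uv and vu may coexist.
record Digraph : Set where
  field
    order    : ℕ
    adj      : Fin order → Fin order → Bool
    loopless : ∀ v → adj v v ≡ false

  Vertex : Set
  Vertex = Fin order

  Arc : Vertex → Vertex → Set
  Arc u v = T (adj u v)

  outNeighbours : Vertex → Subset order
  outNeighbours v = tabulate (adj v)

  outdegree : Vertex → ℕ
  outdegree v = ∣ outNeighbours v ∣

open Digraph public

_≅_ : Digraph → Digraph → Set
G ≅ H = Σ[ φ ∈ Vertex G ↔ Vertex H ]
          (∀ u v → adj G u v ≡ adj H (Inverse.to φ u) (Inverse.to φ v))

-- The minimum is exactly δ and is attained, so G has at least one vertex.
HasMinOutdegree : Digraph → ℕ → Set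
HasMinOutdegree G δ = (∀ v → δ ≤ outdegree G v) × (∃[ v ] outdegree G v ≡ δ)

Colouring : Digraph → ℕ → Set
Colouring G k = Vertex G → Fin k

OutMonochromatic : (G : Digraph) {k : ℕ} → Colouring G k → Vertex G → Set
OutMonochromatic G f v = ∀ u w → Arc G v u → Arc G v w → f u ≡ f w

{-# OPTIONS --safe #-}
-- Let A have 1 + kδ points.  Every k-colouring g of A has a colour class with
-- at least δ points; give A one in-neighbour b_g per g, whose out-neighbourhood
-- is exactly that class.  A colouring f of the whole digraph then makes b_g
-- out-monochromatic for g = f|A.  The arcs leaving A are irrelevant to this, so
-- they go to δ spare vertices, and adding further spare vertices gives
-- infinitely many orders.
module Submission where

open import Data.Bool using (T; true; false)
open import Data.Fin using (Fin; zero; suc; _↑ˡ_; _↑ʳ_; splitAt; funToFin; finToFun)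
open import Data.Fin.Properties using (_≟_; splitAt-↑ˡ; splitAt-↑ʳ; splitAt⁻¹-↑ˡ; finToFun-funToFin)
open import Data.Fin.Permutation using (↔⇒≡)
open import Data.Fin.Subset using (Subset; ∣_∣; ⊥; ⊤)
open import Data.Fin.Subset.Properties using (∣⊥∣≡0; ∣⊤∣≡n)
open import Data.Nat using (ℕ; zero; suc; _+_; _*_; _^_; _≤_; _<_; _≥_; z≤n; s≤s; _<?_; >-nonZero)
open import Data.Nat.Properties using (≤-reflexive; ≤-trans; <⇒≤; ≮⇒≥; n≤1+n; m≤n*m; +-suc; +-identityʳ; +-cancelˡ-≡; +-cancelˡ-<; +-monoˡ-≤; <-≤-trans; +-0-monoid)
open import Data.Product using (Σ-syntax; ∃-syntax; _×_; _,_; proj₁; proj₂)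
open import Data.Sum using (inj₁; inj₂; [_,_]′)
open import Data.Vec using ([]; _∷_; _++_; tabulate; lookup)
open import Data.Vec.Properties using (lookup-splitAt; lookup-replicate; lookup∘tabulate; tabulate∘lookup)
open import Function using (_∘_; const)
open import Relation.Nullary using (¬_; yes; no; does)
open import Relation.Binary.PropositionalEquality using (_≡_; _≢_; refl; sym; trans; cong; subst; module ≡-Reasoning)
open import Defs
open import Algebra.Properties.Monoid.Sum +-0-monoid using (sum)

∣p++q∣≡∣p∣+∣q∣ : ∀ {m n} (p : Subset m) (q : Subset n) → ∣ p ++ q ∣ ≡ ∣ p ∣ + ∣ q ∣
∣p++q∣≡∣p∣+∣q∣ []          q = refl
∣p++q∣≡∣p∣+∣q∣ (true  ∷ p) q = cong suc (∣p++q∣≡∣p∣+∣q∣ p q)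
∣p++q∣≡∣p∣+∣q∣ (false ∷ p) q = ∣p++q∣≡∣p∣+∣q∣ p q

∣⊥++p∣≡∣p∣ : ∀ m {n} (p : Subset n) → ∣ ⊥ {m} ++ p ∣ ≡ ∣ p ∣
∣⊥++p∣≡∣p∣ m p = trans (∣p++q∣≡∣p∣+∣q∣ (⊥ {m}) p) (cong (_+ ∣ p ∣) (∣⊥∣≡0 m))

∣p++⊥∣≡∣p∣ : ∀ {m} n (p : Subset m) → ∣ p ++ ⊥ {n} ∣ ≡ ∣ p ∣
∣p++⊥∣≡∣p∣ n p = begin
  ∣ p ++ ⊥ {n} ∣     ≡⟨ ∣p++q∣≡∣p∣+∣q∣ p ⊥ ⟩
  ∣ p ∣ + ∣ ⊥ {n} ∣  ≡⟨ cong (∣ p ∣ +_) (∣⊥∣≡0 n) ⟩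
  ∣ p ∣ + 0          ≡⟨ +-identityʳ _ ⟩
  ∣ p ∣              ∎
  where open ≡-Reasoning

colourClass : ∀ {n k} → (Fin n → Fin k) → Fin k → Subset n
colourClass g c = tabulate λ v → does (g v ≟ c)

-- A new point of colour `c` enlarges exactly one of the `k` subsets, the one indexed by `c`.
sum-∣≟∷∣ : ∀ {k n} (c : Fin k) (p : Fin k → Subset n) →
           sum (λ d → ∣ does (c ≟ d) ∷ p d ∣) ≡ suc (sum (∣_∣ ∘ p))
sum-∣≟∷∣ zero    p = refl
sum-∣≟∷∣ (suc c) p = trans (cong (∣ p zero ∣ +_) (sum-∣≟∷∣ c (p ∘ suc))) (+-suc _ _)

n≤sum-∣colourClass∣ : ∀ {n k} (g : Fin n → Fin k) → n ≤ sum (∣_∣ ∘ colourClass g)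
n≤sum-∣colourClass∣ {zero}  g = z≤n
n≤sum-∣colourClass∣ {suc n} g = ≤-trans (s≤s (n≤sum-∣colourClass∣ (g ∘ suc)))
  (≤-reflexive (sym (sum-∣≟∷∣ (g zero) (colourClass (g ∘ suc)))))

-- Pigeonhole by induction on `k`. With no summands the hypothesis reads `0 < 0`, so that case needs
-- no clause.
k*δ<sum⇒∃>δ : ∀ {k} δ (h : Fin k → ℕ) → k * δ < sum h → ∃[ c ] δ < h c
k*δ<sum⇒∃>δ {suc k} δ h lt with δ <? h zero
... | yes δ<h₀ = zero , δ<h₀
... | no  δ≮h₀ =
  let c , δ<hc = k*δ<sum⇒∃>δ δ (h ∘ suc)
        -- Here `h zero ≤ δ`, so `δ + k * δ < δ + sum (h ∘ suc)`, and `δ` cancels.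
        (+-cancelˡ-< δ _ _ (<-≤-trans lt (+-monoˡ-≤ _ (≮⇒≥ δ≮h₀))))
  in suc c , δ<hc

largeColourClass : ∀ {k} δ (g : Fin (suc (k * δ)) → Fin k) → ∃[ c ] δ < ∣ colourClass g c ∣
largeColourClass δ g = k*δ<sum⇒∃>δ δ (∣_∣ ∘ colourClass g) (n≤sum-∣colourClass∣ g)

module Bipartite {m n} (right : Fin m → Subset n) (left : Fin n → Subset m) where

  -- Each out-neighbourhood is padded with `⊥` on the vertex's own side, which excludes loops and
  -- keeps its size.
  out : Fin (m + n) → Subset (m + n)
  out u = [ (λ a → ⊥ ++ right a) , (λ b → left b ++ ⊥) ]′ (splitAt m u)

  out-loopless : ∀ v → lookup (out v) v ≡ false
  out-loopless v with splitAt m v in eq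
  ... | inj₁ a rewrite lookup-splitAt m ⊥ (right a) v | eq = lookup-replicate a false
  ... | inj₂ b rewrite lookup-splitAt m (left b) ⊥ v  | eq = lookup-replicate b false

  bipartite : Digraph
  bipartite = record
    { order    = m + n
    ; adj      = λ u → lookup (out u)
    ; loopless = out-loopless
    }

  outdegree≡∣out∣ : ∀ u → outdegree bipartite u ≡ ∣ out u ∣
  outdegree≡∣out∣ u = cong ∣_∣ (tabulate∘lookup (out u))

  outdegree-↑ˡ : ∀ a → outdegree bipartite (a ↑ˡ n) ≡ ∣ right a ∣
  outdegree-↑ˡ a = trans (outdegree≡∣out∣ (a ↑ˡ n)) ∣out∣
    where
    ∣out∣ : ∣ out (a ↑ˡ n) ∣ ≡ ∣ right a ∣
    ∣out∣ rewrite splitAt-↑ˡ m a n = ∣⊥++p∣≡∣p∣ m (right a)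

  outdegree-bound : ∀ {δ} → (∀ a → δ ≤ ∣ right a ∣) → (∀ b → δ ≤ ∣ left b ∣) →
                    ∀ u → δ ≤ outdegree bipartite u
  outdegree-bound {δ} δ≤right δ≤left u =
    subst (δ ≤_) (sym (outdegree≡∣out∣ u)) ∣out∣
    where
    ∣out∣ : δ ≤ ∣ out u ∣
    ∣out∣ with splitAt m u
    ... | inj₁ a = subst (δ ≤_) (sym (∣⊥++p∣≡∣p∣ m (right a))) (δ≤right a)
    ... | inj₂ b = subst (δ ≤_) (sym (∣p++⊥∣≡∣p∣ n (left b))) (δ≤left b)

  arc-↑ʳ : ∀ b u → Arc bipartite (m ↑ʳ b) u → ∃[ a ] (a ↑ˡ n ≡ u × T (lookup (left b) a))
  arc-↑ʳ b u arc rewrite splitAt-↑ʳ m n b | lookup-splitAt m (left b) ⊥ u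
    with splitAt m u in eq
  ... | inj₁ a = a , splitAt⁻¹-↑ˡ eq , arc
  -- A target on the right would lie in the `⊥` padding.
  ... | inj₂ c with () ← subst T (lookup-replicate c false) arc

module Construction (k δ : ℕ) (k≥1 : k ≥ 1) (i : ℕ) where

  points colourings spares : ℕ
  points     = suc (k * δ)
  colourings = k ^ points
  spares     = δ + i

  -- Bounds the outdegree of the spares, each of which sends arcs to all of `points`; `k ≥ 1` gives
  -- `δ ≤ k * δ`.
  δ≤points : δ ≤ points
  δ≤points = ≤-trans (m≤n*m δ k {{>-nonZero k≥1}}) (n≤1+n _)

  right : Fin points → Subset (colourings + spares)
  right _ = ⊥ {colourings} ++ (⊤ {δ} ++ ⊥ {i})

  ∣right∣≡δ : ∀ a → ∣ right a ∣ ≡ δ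
  ∣right∣≡δ _ = trans (∣⊥++p∣≡∣p∣ colourings (⊤ {δ} ++ ⊥ {i}))
                      (trans (∣p++⊥∣≡∣p∣ i (⊤ {δ})) (∣⊤∣≡n δ))

  -- Colourings are coded as numbers below `k ^ points`, so that they can serve as vertices.
  decode : Fin colourings → Fin points → Fin k
  decode = finToFun

  -- A colour used more than `δ` times, not necessarily the most frequent one.
  majority : Fin colourings → Fin k
  majority x = proj₁ (largeColourClass δ (decode x))

  majorityClass : Fin colourings → Subset points
  majorityClass x = colourClass (decode x) (majority x)

  left : Fin (colourings + spares) → Subset points
  left b = [ majorityClass , const ⊤ ]′ (splitAt colourings b)

  δ≤∣left∣ : ∀ b → δ ≤ ∣ left b ∣
  δ≤∣left∣ b with splitAt colourings b
  ... | inj₁ x = <⇒≤ (proj₂ (largeColourClass δ (decode x)))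
  ... | inj₂ _ = subst (δ ≤_) (sym (∣⊤∣≡n points)) δ≤points

  open Bipartite right left public

  minOutdegree : HasMinOutdegree bipartite δ
  minOutdegree =
    outdegree-bound (≤-reflexive ∘ sym ∘ ∣right∣≡δ) δ≤∣left∣ ,
    -- The minimum is attained on the left side, which is never empty and has all outdegrees equal
    -- to `δ`.
    zero {k * δ} ↑ˡ (colourings + spares) , trans (outdegree-↑ˡ zero) (∣right∣≡δ zero)

  left-↑ˡ : ∀ x a → T (lookup (left (x ↑ˡ spares)) a) → decode x a ≡ majority x
  left-↑ˡ x a t
    rewrite splitAt-↑ˡ colourings x spares
          | lookup∘tabulate (λ v → does (decode x v ≟ majority x)) a
    with decode x a ≟ majority x
  ... | yes eq = eq

  outMonochromatic : (f : Colouring bipartite k) → ∃[ v ] OutMonochromatic bipartite f v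
  -- The witness is the vertex coding `f` restricted to the left side; all its out-neighbours lie on
  -- that side.
  outMonochromatic f = points ↑ʳ (x ↑ˡ spares) ,
    λ u w vu vw → trans (colour u vu) (sym (colour w vw))
    where
    restriction : Fin points → Fin k
    restriction a = f (a ↑ˡ _)

    x : Fin colourings
    x = funToFin restriction

    colour : ∀ u → Arc bipartite (points ↑ʳ (x ↑ˡ spares)) u → f u ≡ majority x
    colour u arc with a , refl , t ← arc-↑ʳ (x ↑ˡ spares) u arc =
      trans (sym (finToFun-funToFin restriction a)) (left-↑ˡ x a t)

lemma5 : (k δ : ℕ) → k ≥ 1 →
    Σ[ G ∈ (ℕ → Digraph) ]
    ((∀ i j → i ≢ j → ¬ (G i ≅ G j)) ×
    (∀ i → HasMinOutdegree (G i) δ ×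
    ((f : Colouring (G i) k) → ∃[ v ] OutMonochromatic (G i) f v)))
lemma5 k δ k≥1 =
  bipartite ,
  -- Isomorphic digraphs have equal orders `points + (colourings + (δ + i))`, where only `i` varies;
  -- cancelling the rest gives `i ≡ j`.
  (λ i j i≢j (φ , _) → i≢j (+-cancelˡ-≡ δ i j (+-cancelˡ-≡ (colourings i) _ _
    (+-cancelˡ-≡ (points i) _ _ (↔⇒≡ φ))))) ,
  (λ i → minOutdegree i , outMonochromatic i)
  where open Construction k δ k≥1
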